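{- Let $G$ be a connected simple graph with $n$ vertices and $n+1$ edges belonging to the class $\mathcal{A}(p,q,l)$ for some $p,q,l$. Then $\operatorname{avm}(G)\ge \operatorname{avm}(\theta_n^1(3,3))$, with equality if and only if $G\cong \theta_n^1(3,3)$.
   Context: For a finite simple graph $G$, $\operatorname{avm}(G)$ is the average of $|M|$ over all maximal matchings $M$ of $G$ (a matching is maximal if it is not properly contained in another matching). A connected graph with $n$ vertices and $n+1$ edges contains two induced cycles $C_p$ and $C_q$ (of lengths $p$ and $q$); it belongs to $\mathcal{A}(p,q,l)$ if these cycles have a common path of length $l\ge 1$ (so the union of the cycles is a theta graph). $\theta_n^1(3,3)$ is the graph obtained from two triangles sharing an edge $uv$ (vertices $u,v,x,y$, edges $uv,ux,uy,vx,vy$) by attaching $n-4$ pendant edges (new leaves) to $u$. -}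

module Defs where

open import Data.Bool using (Bool; true; false; T)
open import Data.Bool.Properties using (T?)
open import Data.Fin using (Fin; zero; suc; toℕ; inject₁; splitAt)
import Data.Fin as Fin
import Data.Fin.Properties as Fin
open import Data.Fin.Subset using (Subset; inside; outside; _∈_; _⊂_; ∣_∣; ⊥)
open import Data.Fin.Subset.Induction using (⊃-wellFounded)
open import Data.Fin.Subset.Properties using (_∈?_; _⊂?_; anySubset?; ∉⊥)
open import Data.Integer using (+_)
open import Data.List using (List; []; _∷_; _++_; map; filter; length; lookup; allFin; cartesianProduct)
import Data.List.Membership.Propositional as List
open import Data.List.Membership.Propositional.Properties using (∈-++⁺ˡ; ∈-++⁺ʳ; ∈-map⁺; ∈-filter⁺)
open import Data.List.Relation.Unary.Any using (here; there)
open import Data.Nat using (ℕ; zero; suc; _+_; _∸_; _≤_; NonZero)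
open import Data.Nat.ListAction using (sum)
open import Data.Product using (∃; ∃-syntax; _×_; _,_; proj₁; proj₂)
open import Data.Rational using (ℚ; _/_)
open import Data.Sum using (_⊎_; inj₁; inj₂)
open import Data.Vec using ([]; _∷_)
open import Function using (_⇔_; _↔_; Inverse)
open import Function.Definitions using (Injective)
open import Induction.WellFounded using (Acc; acc)
open import Relation.Binary.Construct.Closure.ReflexiveTransitive using (Star)
open import Relation.Binary.PropositionalEquality using (_≡_; refl)
open import Relation.Nullary using (¬_; Dec; yes; no; contradiction)
open import Relation.Nullary.Decidable using (_×-dec_; _⊎-dec_; _→-dec_; ¬?; ⌊_⌋)

record Graph (n : ℕ) : Set where
  field
    adj        : Fin n → Fin n → Bool
    adj-sym    : ∀ i j → adj i j ≡ adj j i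
    adj-irrefl : ∀ i → adj i i ≡ false

  Adj : Fin n → Fin n → Set
  Adj i j = T (adj i j)

  -- Each edge {i , j} is listed once, as the pair with i < j.
  edges : List (Fin n × Fin n)
  edges = filter (λ (i , j) → (i Fin.<? j) ×-dec T? (adj i j))
                 (cartesianProduct (allFin n) (allFin n))

  size : ℕ
  size = length edges

  Edge : Set
  Edge = Fin size

  Incident : Fin n → Edge → Set
  Incident v e = v ≡ proj₁ (lookup edges e) ⊎ v ≡ proj₂ (lookup edges e)

open Graph public using (Adj; size)

Connected : ∀ {n} → Graph n → Set
Connected G = ∀ u v → Star (Adj G) u v

record _≅_ {m n} (G : Graph m) (H : Graph n) : Set where
  field
    bijection : Fin m ↔ Fin n
    preserves : ∀ i j → Graph.adj H (Inverse.to bijection i) (Inverse.to bijection j)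
                        ≡ Graph.adj G i j

infix 4 _≅_

allSubsets : ∀ m → List (Subset m)
allSubsets zero    = [] ∷ []
allSubsets (suc m) = map (inside ∷_) (allSubsets m) ++ map (outside ∷_) (allSubsets m)

∈-allSubsets : ∀ {m} (S : Subset m) → S List.∈ allSubsets m
∈-allSubsets []            = here refl
∈-allSubsets (inside  ∷ S) = ∈-++⁺ˡ (∈-map⁺ (inside ∷_) (∈-allSubsets S))
∈-allSubsets (outside ∷ S) =
  ∈-++⁺ʳ (map (inside ∷_) (allSubsets _)) (∈-map⁺ (outside ∷_) (∈-allSubsets S))

module _ {n} (G : Graph n) where
  open Graph G using (edges; Edge; Incident)

  EdgeSet : Set
  EdgeSet = Subset (size G)

  IsMatching : EdgeSet → Set
  IsMatching M = ∀ e → e ∈ M → ∀ f → f ∈ M →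
                 ∀ v → Incident v e → Incident v f → e ≡ f

  IsMaximalMatching : EdgeSet → Set
  IsMaximalMatching M = IsMatching M × ¬ (∃[ N ] IsMatching N × M ⊂ N)

  incident? : ∀ v e → Dec (Incident v e)
  incident? v e = (v Fin.≟ proj₁ (lookup edges e)) ⊎-dec (v Fin.≟ proj₂ (lookup edges e))

  isMatching? : ∀ M → Dec (IsMatching M)
  isMatching? M =
    Fin.all? λ e → (e ∈? M) →-dec Fin.all? λ f → (f ∈? M) →-dec
    Fin.all? λ v → incident? v e →-dec (incident? v f →-dec (e Fin.≟ f))

  isMaximalMatching? : ∀ M → Dec (IsMaximalMatching M)
  isMaximalMatching? M =
    isMatching? M ×-dec ¬? (anySubset? λ N → isMatching? N ×-dec (M ⊂? N))

  maximalMatchings : List EdgeSet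
  maximalMatchings = filter isMaximalMatching? (allSubsets (size G))

  extendToMaximal : ∀ M → Acc (λ N N′ → N′ ⊂ N) M → IsMatching M → ∃ IsMaximalMatching
  extendToMaximal M (acc rec) matching
    with anySubset? (λ N → isMatching? N ×-dec (M ⊂? N))
  ... | yes (N , matchingN , M⊂N) = extendToMaximal N (rec M⊂N) matchingN
  ... | no maximal                = M , matching , maximal

  maximalMatching-exists : ∃ IsMaximalMatching
  maximalMatching-exists =
    extendToMaximal ⊥ (⊃-wellFounded ⊥) (λ e e∈⊥ → contradiction e∈⊥ ∉⊥)

  length-nonZero : ∀ {M} {Ms : List EdgeSet} → M List.∈ Ms → NonZero (length Ms)
  length-nonZero (here  _) = _
  length-nonZero (there _) = _

  maximalMatchings-nonZero : NonZero (length maximalMatchings)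
  maximalMatchings-nonZero =
    let M , maximal = maximalMatching-exists
    in length-nonZero (∈-filter⁺ isMaximalMatching? (∈-allSubsets M) maximal)

  avm : ℚ
  avm = _/_ (+ sum (map ∣_∣ maximalMatchings)) (length maximalMatchings)
            {{maximalMatchings-nonZero}}

CyclicSucc : ∀ {p} → Fin p → Fin p → Set
CyclicSucc {p} i j = toℕ j ≡ suc (toℕ i) ⊎ (suc (toℕ i) ≡ p × toℕ j ≡ 0)

CyclicAdj : ∀ {p} → Fin p → Fin p → Set
CyclicAdj i j = CyclicSucc i j ⊎ CyclicSucc j i

record InducedCycle {n} (G : Graph n) (p : ℕ) : Set where
  field
    p≥3       : 3 ≤ p
    vertex    : Fin p → Fin n
    injective : Injective _≡_ _≡_ vertex
    induced   : ∀ i j → Adj G (vertex i) (vertex j) ⇔ CyclicAdj i j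

  HasVertex : Fin n → Set
  HasVertex x = ∃[ i ] vertex i ≡ x

  HasEdge : Fin n → Fin n → Set
  HasEdge x y = ∃[ i ] ∃[ j ] CyclicAdj i j × vertex i ≡ x × vertex j ≡ y

-- l is the number of edges.
record Path {n} (G : Graph n) (l : ℕ) : Set where
  field
    vertex    : Fin (suc l) → Fin n
    injective : Injective _≡_ _≡_ vertex
    adjacent  : ∀ (i : Fin l) → Adj G (vertex (inject₁ i)) (vertex (suc i))

  HasVertex : Fin n → Set
  HasVertex x = ∃[ i ] vertex i ≡ x

  HasEdge : Fin n → Fin n → Set
  HasEdge x y = ∃[ i ] ((vertex (inject₁ i) ≡ x × vertex (suc i) ≡ y)
                      ⊎ (vertex (inject₁ i) ≡ y × vertex (suc i) ≡ x))

-- The intersection of the two cycles, as subgraphs, is a path of length l.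
-- Since a cycle is not a path, this forces the cycles to be distinct.
record 𝒜 (p q l : ℕ) {n} (G : Graph n) : Set where
  field
    l≥1  : 1 ≤ l
    C    : InducedCycle G p
    D    : InducedCycle G q
    path : Path G l
    commonVertices : ∀ x →
      (InducedCycle.HasVertex C x × InducedCycle.HasVertex D x) ⇔ Path.HasVertex path x
    commonEdges : ∀ x y →
      (InducedCycle.HasEdge C x y × InducedCycle.HasEdge D x y) ⇔ Path.HasEdge path x y

-- Two triangles sharing an edge: u, v, x, y are 0, 1, 2, 3, and xy is the
-- only non-adjacent pair of distinct vertices.
diamond : Graph 4
diamond = record { adj = a ; adj-sym = a-sym ; adj-irrefl = a-irrefl }
  where
  pattern u = zero
  pattern v = suc zero
  pattern x = suc (suc zero)
  pattern y = suc (suc (suc zero))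

  a : Fin 4 → Fin 4 → Bool
  a u v = true
  a u x = true
  a u y = true
  a v x = true
  a v y = true
  a v u = true
  a x u = true
  a y u = true
  a x v = true
  a y v = true
  a _ _ = false

  a-sym : ∀ i j → a i j ≡ a j i
  a-sym u u = refl
  a-sym u v = refl
  a-sym u x = refl
  a-sym u y = refl
  a-sym v u = refl
  a-sym v v = refl
  a-sym v x = refl
  a-sym v y = refl
  a-sym x u = refl
  a-sym x v = refl
  a-sym x x = refl
  a-sym x y = refl
  a-sym y u = refl
  a-sym y v = refl
  a-sym y x = refl
  a-sym y y = refl

  a-irrefl : ∀ i → a i i ≡ false
  a-irrefl u = refl
  a-irrefl v = refl
  a-irrefl x = refl
  a-irrefl y = refl

attachLeaves : ∀ {m} → Graph m → Fin m → (k : ℕ) → Graph (m + k)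
attachLeaves {m} G u k = record
  { adj        = λ i j → a (splitAt m i) (splitAt m j)
  ; adj-sym    = λ i j → a-sym (splitAt m i) (splitAt m j)
  ; adj-irrefl = λ i → a-irrefl (splitAt m i)
  }
  where
  a : Fin m ⊎ Fin k → Fin m ⊎ Fin k → Bool
  a (inj₁ i) (inj₁ j) = Graph.adj G i j
  a (inj₁ i) (inj₂ _) = ⌊ i Fin.≟ u ⌋
  a (inj₂ _) (inj₁ j) = ⌊ j Fin.≟ u ⌋
  a (inj₂ _) (inj₂ _) = false

  a-sym : ∀ s t → a s t ≡ a t s
  a-sym (inj₁ i) (inj₁ j) = Graph.adj-sym G i j
  a-sym (inj₁ _) (inj₂ _) = refl
  a-sym (inj₂ _) (inj₁ _) = refl
  a-sym (inj₂ _) (inj₂ _) = refl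

  a-irrefl : ∀ s → a s s ≡ false
  a-irrefl (inj₁ i) = Graph.adj-irrefl G i
  a-irrefl (inj₂ _) = refl

-- For n ≥ 4 this has n vertices. Smaller n carry no meaning, and no graph
-- with n < 4 vertices has n + 1 edges.
θ¹₃₃ : (n : ℕ) → Graph (4 + (n ∸ 4))
θ¹₃₃ n = attachLeaves diamond zero (n ∸ 4)

{-# OPTIONS --safe #-}
-- If every edge of G is disjoint from some other edge, all maximal matchings
-- have at least two edges and avm(G) ≥ 2 > avm(θ). Otherwise some edge ab meets
-- every edge; then every other vertex is adjacent to a or b, and counting n + 1
-- edges shows that a and b have exactly two common neighbours. With 2 + s and
-- 2 + t the numbers of neighbours of a and b outside {a, b}, so that
-- s + t = n - 4, the maximal matchings are {ab} and the pairs {ax, by} with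
-- x ≠ y, so there are N = (2 + s)(2 + t) - 1 = 2n - 5 + st of them and
-- avm(G) = 2 - 1/N. This is least exactly when st = 0, i.e. G ≅ θ.
module Submission where

open import Defs
open import Data.Bool using (true; false; T)
open import Data.Bool.Properties using (T?)
open import Data.Fin using (Fin; zero; suc)
open import Data.Fin.Patterns using (0F; 1F; 2F; 3F)
import Data.Fin as Fin
import Data.Fin.Properties as Fin
open import Data.Fin.Permutation using (↔⇒≡)
open import Data.Fin.Subset using (inside; outside; _∈_; _⊂_; ∣_∣; ⁅_⁆; _∪_)
open import Data.Fin.Subset.Properties using (_∈?_; x∈⁅x⁆; x∈⁅y⁆⇒x≡y; x∈p∪q⁻; x∈p∪q⁺; p⊆p∪q; q⊆p∪q; ⊆-antisym; ∪-identityˡ; ∪-identityʳ; ∣⁅x⁆∣≡1; p⊆q⇒∣p∣≤∣q∣)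
import Data.Integer as ℤ
import Data.Integer.Properties as ℤ
open import Data.List using (List; []; _∷_; _++_; map; filter; length; lookup; allFin; cartesianProduct)
import Data.List.Membership.Propositional as List
open import Data.List.Membership.Propositional.Properties using (∈-filter⁺; ∈-filter⁻; ∈-lookup; ∈-map⁺; ∈-map⁻; ∈-++⁺ˡ; ∈-++⁺ʳ; ∈-++⁻; ∈-allFin; ∈-cartesianProduct⁺; ∈-cartesianProduct⁻)
open import Data.List.Membership.Propositional.Properties.WithK using (unique∧set⇒bag)
open import Data.List.Properties using (length-map; length-++; length-tabulate)
open import Data.List.Relation.Binary.BagAndSetEquality using (∼bag⇒↭)
open import Data.List.Relation.Binary.Permutation.Propositional using (_↭_)
open import Data.List.Relation.Binary.Permutation.Propositional.Properties using (↭-length) renaming (map⁺ to ↭-map⁺)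
open import Data.List.Relation.Unary.All as All using (All; []; _∷_)
open import Data.List.Relation.Unary.All.Properties using (all-filter) renaming (map⁺ to All-map⁺)
open import Data.List.Relation.Unary.AllPairs using ([]; _∷_)
open import Data.List.Relation.Unary.Any using (here; there; index)
open import Data.List.Relation.Unary.Any.Properties using (lookup-index)
open import Data.List.Relation.Unary.Unique.Propositional using (Unique)
import Data.List.Relation.Unary.Unique.Propositional.Properties as Unique
open import Data.Nat using (ℕ; zero; suc; _+_; _*_; _∸_; NonZero; z≤n; s≤s)
import Data.Nat as ℕ
open import Data.Nat.ListAction using (sum)
open import Data.Nat.ListAction.Properties using (sum-↭)
import Data.Nat.Properties as ℕ
open import Data.Nat.Solver using (module +-*-Solver)
open import Data.Product using (∃; ∃-syntax; _×_; _,_; proj₁; proj₂)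
open import Data.Rational using (_/_; _≤_)
import Data.Rational.Properties as ℚ
open import Data.Rational.Unnormalised using (mkℚᵘ; *≤*)
import Data.Rational.Unnormalised.Properties as ℚᵘ
open import Data.Sum using (_⊎_; inj₁; inj₂; [_,_]′)
import Data.Sum as Sum
open import Data.Vec using ([]; _∷_)
import Data.Vec.Properties as Vec
open import Function using (_⇔_; mk⇔; _↔_; mk↔ₛ′; Inverse; _∘_; id)
open import Relation.Binary.Construct.Closure.ReflexiveTransitive using (Star; ε; _◅_)
open import Relation.Binary.Definitions using (tri<; tri≈; tri>)
open import Relation.Binary.PropositionalEquality using (_≡_; _≢_; refl; sym; trans; cong; cong₂; subst; subst₂; module ≡-Reasoning)
open import Relation.Nullary using (¬_; Dec; yes; no; contradiction; does)
open import Relation.Nullary.Decidable using (_×-dec_; _⊎-dec_; ¬?)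
open import Relation.Unary using (Decidable)

-- The two common neighbours keep the list of maximal matchings short: each of `a` and `b` has at
-- least two neighbours besides the other, and a single edge at the other end can block only one of
-- them, so no maximal matching leaves `a` or `b` unsaturated. The matchings of θ are not enumerated
-- separately. `LeafyDiamond` records what the argument needs of θ: an edge `ab` meeting every edge,
-- with two common neighbours of its ends, where `b` has no further neighbours. Graphs isomorphic to
-- θ have this structure, so the general count applies to them; conversely the structure forces an
-- isomorphism with θ. All averages compared in the covered case have the form (2N - 1)/N, so
-- comparing them amounts to comparing the counts N. This is done by cross multiplication over the
-- natural numbers, with subtractions moved to the other side.

-- Counting with duplicate-free lists

module _ {A : Set} where

  -- Source of the enumerations of vertices, edges and maximal matchings below: lengths and sums are
  -- invariant under permutation, so it is enough to exhibit an explicit duplicate-free list and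
  -- check membership both ways.
  unique-↭ : {xs ys : List A} → Unique xs → Unique ys →
             (∀ {z} → z List.∈ xs → z List.∈ ys) → (∀ {z} → z List.∈ ys → z List.∈ xs) → xs ↭ ys
  unique-↭ xs! ys! to from = ∼bag⇒↭ (unique∧set⇒bag xs! ys! (mk⇔ to from))

  -- Injectivity is asked only on `P`, because `link` has a junk value outside the neighbours and is
  -- injective only on them.
  unique-map : {B : Set} {P : A → Set} (f : A → B) →
               (∀ {x y} → P x → P y → f x ≡ f y → x ≡ y) →
               ∀ {xs} → All P xs → Unique xs → Unique (map f xs)
  unique-map f inj []         []           = []
  unique-map {P = P} f inj (px ∷ pxs) (x∉xs ∷ xs!) = fresh pxs x∉xs ∷ unique-map f inj pxs xs!
    where
    fresh : ∀ {ys} → All P ys → All (_ ≢_) ys → All (f _ ≢_) (map f ys)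
    fresh []         []           = []
    fresh (py ∷ pys) (x≢y ∷ x≢ys) = (λ eq → x≢y (inj px py eq)) ∷ fresh pys x≢ys

  module _ {P Q : A → Set} (P? : Decidable P) (Q? : Decidable Q) where

    -- Inclusion-exclusion, used for the neighbours of the two ends of an edge.
    length-filter-⊎-× : ∀ xs →
      length (filter P? xs) + length (filter Q? xs) ≡
      length (filter (λ x → P? x ⊎-dec Q? x) xs) + length (filter (λ x → P? x ×-dec Q? x) xs)
    length-filter-⊎-× []       = refl
    length-filter-⊎-× (x ∷ xs) with ih ← length-filter-⊎-× xs | does (P? x) | does (Q? x)
    ... | true  | true  = cong suc (trans (ℕ.+-suc _ _) (trans (cong suc ih) (sym (ℕ.+-suc _ _))))
    ... | true  | false = cong suc ih
    ... | false | true  = trans (ℕ.+-suc _ _) (cong suc ih)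
    ... | false | false = ih

  length-filter-¬ : {P : A → Set} (P? : Decidable P) → ∀ xs →
    length (filter (λ x → ¬? (P? x)) xs) + length (filter P? xs) ≡ length xs
  length-filter-¬ P? []       = refl
  length-filter-¬ P? (x ∷ xs) with ih ← length-filter-¬ P? xs | does (P? x)
  ... | true  = trans (ℕ.+-suc _ _) (cong suc ih)
  ... | false = cong suc ih

  length-cartesianProduct : {B : Set} (xs : List A) (ys : List B) →
    length (cartesianProduct xs ys) ≡ length xs * length ys
  length-cartesianProduct []       ys = refl
  length-cartesianProduct (x ∷ xs) ys =
    trans (length-++ (map (x ,_) ys)) (cong₂ _+_ (length-map (x ,_) ys) (length-cartesianProduct xs ys))

  sum-map-const : (f : A → ℕ) (k : ℕ) → ∀ {xs} → All (λ x → f x ≡ k) xs → sum (map f xs) ≡ length xs * k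
  sum-map-const f k []         = refl
  sum-map-const f k (eq ∷ eqs) = cong₂ _+_ eq (sum-map-const f k eqs)

  sum-map-≥ : (f : A → ℕ) (k : ℕ) → ∀ {xs} → All (λ x → k ℕ.≤ f x) xs → length xs * k ℕ.≤ sum (map f xs)
  sum-map-≥ f k []         = z≤n
  sum-map-≥ f k (le ∷ les) = ℕ.+-mono-≤ le (sum-map-≥ f k les)

  lookup-injective : ∀ {xs : List A} → Unique xs → ∀ i j → lookup xs i ≡ lookup xs j → i ≡ j
  lookup-injective (x∉ ∷ xs!) zero    zero    eq = refl
  lookup-injective (x∉ ∷ xs!) zero    (suc j) eq = contradiction eq (All.lookup x∉ (∈-lookup j))
  lookup-injective (x∉ ∷ xs!) (suc i) zero    eq = contradiction (sym eq) (All.lookup x∉ (∈-lookup i))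
  lookup-injective (x∉ ∷ xs!) (suc i) (suc j) eq = cong suc (lookup-injective xs! i j eq)

  length≡2⇒pair : ∀ {xs : List A} → length xs ≡ 2 → Unique xs →
                  ∃[ c ] ∃[ d ] c List.∈ xs × d List.∈ xs × c ≢ d
  length≡2⇒pair {c ∷ d ∷ []} refl ((c≢d ∷ _) ∷ _) = c , d , here refl , there (here refl) , c≢d

  pair⇒length≥2 : ∀ {xs : List A} {c d} → c List.∈ xs → d List.∈ xs → c ≢ d → 2 ℕ.≤ length xs
  pair⇒length≥2 (here refl)        (here refl)        c≢d = contradiction refl c≢d
  pair⇒length≥2 (here _)           (there (here _))   _   = s≤s (s≤s z≤n)
  pair⇒length≥2 (here _)           (there (there _))  _   = s≤s (s≤s z≤n)
  pair⇒length≥2 (there (here _))   _                  _   = s≤s (s≤s z≤n)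
  pair⇒length≥2 (there (there _))  _                  _   = s≤s (s≤s z≤n)

  pair-exhausts : ∀ {xs : List A} {c d v} → length xs ≡ 2 → c List.∈ xs → d List.∈ xs → c ≢ d →
                  v List.∈ xs → v ≡ c ⊎ v ≡ d
  pair-exhausts {_ ∷ _ ∷ []} refl (here refl)         (here refl)         c≢d _                   = contradiction refl c≢d
  pair-exhausts {_ ∷ _ ∷ []} refl (there (here refl)) (there (here refl)) c≢d _                   = contradiction refl c≢d
  pair-exhausts {_ ∷ _ ∷ []} refl (here refl)         (there (here refl)) c≢d (here refl)         = inj₁ refl
  pair-exhausts {_ ∷ _ ∷ []} refl (here refl)         (there (here refl)) c≢d (there (here refl)) = inj₂ refl
  pair-exhausts {_ ∷ _ ∷ []} refl (there (here refl)) (here refl)         c≢d (here refl)         = inj₂ refl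
  pair-exhausts {_ ∷ _ ∷ []} refl (there (here refl)) (here refl)         c≢d (there (here refl)) = inj₁ refl

  length≡2 : ∀ {xs : List A} {c d} → Unique xs → c List.∈ xs → d List.∈ xs → c ≢ d →
             (∀ {v} → v List.∈ xs → v ≡ c ⊎ v ≡ d) → length xs ≡ 2
  length≡2 {c = c} {d} xs! c∈ d∈ c≢d only = ↭-length (unique-↭ xs! ((c≢d ∷ []) ∷ [] ∷ [])
    (λ v∈ → [ here , (λ v≡d → there (here v≡d)) ]′ (only v∈))
    λ { (here refl) → c∈ ; (there (here refl)) → d∈ })

∣⁅x⁆∪⁅y⁆∣≡2 : ∀ {n} {x y : Fin n} → x ≢ y → ∣ ⁅ x ⁆ ∪ ⁅ y ⁆ ∣ ≡ 2
∣⁅x⁆∪⁅y⁆∣≡2 {x = zero}  {zero}  x≢y = contradiction refl x≢y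
∣⁅x⁆∪⁅y⁆∣≡2 {x = zero}  {suc y} x≢y = cong suc (trans (cong ∣_∣ (∪-identityˡ ⁅ y ⁆)) (∣⁅x⁆∣≡1 y))
∣⁅x⁆∪⁅y⁆∣≡2 {x = suc x} {zero}  x≢y = cong suc (trans (cong ∣_∣ (∪-identityʳ ⁅ x ⁆)) (∣⁅x⁆∣≡1 x))
∣⁅x⁆∪⁅y⁆∣≡2 {x = suc x} {suc y} x≢y = ∣⁅x⁆∪⁅y⁆∣≡2 (x≢y ∘ cong suc)

allSubsets-unique : ∀ m → Unique (allSubsets m)
allSubsets-unique zero    = [] ∷ []
allSubsets-unique (suc m) = Unique.++⁺
  (Unique.map⁺ Vec.∷-injectiveʳ (allSubsets-unique m))
  (Unique.map⁺ Vec.∷-injectiveʳ (allSubsets-unique m))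
  λ (p , q) → disjoint (∈-map⁻ (inside ∷_) p) (∈-map⁻ (outside ∷_) q)
  where
  disjoint : ∀ {S} → (∃[ T ] T List.∈ allSubsets m × S ≡ inside ∷ T) →
             ¬ (∃[ T ] T List.∈ allSubsets m × S ≡ outside ∷ T)
  disjoint (_ , _ , refl) (_ , _ , ())

-- Edges, and maximal matchings as dominating matchings

module _ {n} (G : Graph n) where
  open Graph G using (adj; adj-sym; adj-irrefl; edges; Edge; Incident)

  Adj-sym : ∀ {i j} → Adj G i j → Adj G j i
  Adj-sym = subst T (adj-sym _ _)

  Adj⇒≢ : ∀ {i j} → Adj G i j → i ≢ j
  Adj⇒≢ i~i refl = subst T (adj-irrefl _) i~i

  edge? : Decidable (λ ((i , j) : Fin n × Fin n) → i Fin.< j × Adj G i j)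
  edge? (i , j) = (i Fin.<? j) ×-dec T? (adj i j)

  edge-ends : ∀ e → let (i , j) = lookup edges e in i Fin.< j × Adj G i j
  edge-ends e = proj₂ (∈-filter⁻ edge? {xs = cartesianProduct (allFin n) (allFin n)} (∈-lookup e))

  edges-unique : Unique edges
  edges-unique = Unique.filter⁺ edge? (Unique.cartesianProduct⁺ (Unique.allFin⁺ n) (Unique.allFin⁺ n))

  incident-adj : ∀ {i j e} → i ≢ j → Incident i e → Incident j e → Adj G i j
  incident-adj i≢j (inj₁ refl) (inj₁ refl) = contradiction refl i≢j
  incident-adj {e = e} i≢j (inj₁ refl) (inj₂ refl) = proj₂ (edge-ends e)
  incident-adj {e = e} i≢j (inj₂ refl) (inj₁ refl) = Adj-sym (proj₂ (edge-ends e))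
  incident-adj i≢j (inj₂ refl) (inj₂ refl) = contradiction refl i≢j

  incident-third : ∀ {i j k e} → i ≢ j → Incident i e → Incident j e → Incident k e → k ≡ i ⊎ k ≡ j
  incident-third i≢j (inj₁ refl) (inj₁ refl) _           = contradiction refl i≢j
  incident-third i≢j (inj₁ refl) (inj₂ refl) k           = k
  incident-third i≢j (inj₂ refl) (inj₁ refl) k           = Sum.swap k
  incident-third i≢j (inj₂ refl) (inj₂ refl) _           = contradiction refl i≢j

  otherEnd : ∀ {i e} → Incident i e → ∃[ j ] i ≢ j × Incident j e
  otherEnd {e = e} (inj₁ refl) = _ , Adj⇒≢ (proj₂ (edge-ends e)) , inj₂ refl
  otherEnd {e = e} (inj₂ refl) = _ , Adj⇒≢ (proj₂ (edge-ends e)) ∘ sym , inj₁ refl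

  Links : Fin n → Fin n → Edge → Set
  Links i j e = Incident i e × Incident j e

  private
    listed : ∀ {i j} → i Fin.< j → Adj G i j → ∃[ e ] lookup edges e ≡ (i , j)
    listed i<j i~j = index ij∈ , sym (lookup-index ij∈)
      where ij∈ = ∈-filter⁺ edge? (∈-cartesianProduct⁺ (∈-allFin _) (∈-allFin _)) (i<j , i~j)

  link-exists : ∀ {i j} → Adj G i j → ∃ (Links i j)
  link-exists {i} {j} i~j with Fin.<-cmp i j
  ... | tri< i<j _ _ = let e , eq = listed i<j i~j
                       in e , inj₁ (sym (cong proj₁ eq)) , inj₂ (sym (cong proj₂ eq))
  ... | tri≈ _ i≡j _ = contradiction i≡j (Adj⇒≢ i~j)
  ... | tri> _ _ j<i = let e , eq = listed j<i (Adj-sym i~j)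
                       in e , inj₂ (sym (cong proj₂ eq)) , inj₁ (sym (cong proj₁ eq))

  -- An edge is listed only with its smaller end first, so opposite orientations would give both i <
  -- j and j < i. With equal orientations the list entries agree, and the list has no duplicates.
  link-unique : ∀ {i j e f} → i ≢ j → Links i j e → Links i j f → e ≡ f
  link-unique {i} {j} {e} {f} i≢j (ie , je) (if , jf) =
    lookup-injective edges-unique e f (ends (orient ie je) (orient if jf))
    where
    orient : ∀ {g} → Incident i g → Incident j g → lookup edges g ≡ (i , j) ⊎ lookup edges g ≡ (j , i)
    orient (inj₁ p) (inj₁ q) = contradiction (trans p (sym q)) i≢j
    orient (inj₁ p) (inj₂ q) = inj₁ (sym (cong₂ _,_ p q))
    orient (inj₂ p) (inj₁ q) = inj₂ (sym (cong₂ _,_ q p))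
    orient (inj₂ p) (inj₂ q) = contradiction (trans p (sym q)) i≢j

    order : ∀ g {x y} → lookup edges g ≡ (x , y) → x Fin.< y
    order g refl = proj₁ (edge-ends g)

    ends : lookup edges e ≡ (i , j) ⊎ lookup edges e ≡ (j , i) →
           lookup edges f ≡ (i , j) ⊎ lookup edges f ≡ (j , i) → lookup edges e ≡ lookup edges f
    ends (inj₁ p) (inj₁ q) = trans p (sym q)
    ends (inj₁ p) (inj₂ q) = contradiction (order f q) (Fin.<-asym (order e p))
    ends (inj₂ p) (inj₁ q) = contradiction (order f q) (Fin.<-asym (order e p))
    ends (inj₂ p) (inj₂ q) = trans p (sym q)

  Meets : Edge → Edge → Set
  Meets e f = ∃[ v ] Incident v e × Incident v f

  meets? : ∀ e f → Dec (Meets e f)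
  meets? e f = Fin.any? λ v → incident? G v e ×-dec incident? G v f

  meets-refl : ∀ e → Meets e e
  meets-refl e = _ , inj₁ refl , inj₁ refl

  Dominates : EdgeSet G → Edge → Set
  Dominates M f = ∃[ e ] e ∈ M × Meets e f

  -- An additional edge `f` of a larger matching would share a vertex with some `e` in `M`, hence
  -- equal `e` and lie in `M` already. Together with the converse this replaces the quantification
  -- over all larger edge sets by a condition on single edges.
  dominating⇒maximal : ∀ {M} → IsMatching G M → (∀ f → Dominates M f) → IsMaximalMatching G M
  dominating⇒maximal {M} matching dom = matching , λ
    { (N , matchingN , M⊆N , f , f∈N , f∉M) →
      let e , e∈M , v , ve , vf = dom f
      in f∉M (subst (_∈ M) (matchingN e (M⊆N e∈M) f f∈N v ve vf) e∈M) }

  -- If no edge of `M` met `f`, then `M` with `f` added would be a larger matching; it is strictly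
  -- larger since `f` meets itself.
  maximal⇒dominating : ∀ {M} → IsMaximalMatching G M → ∀ f → Dominates M f
  maximal⇒dominating {M} (matching , maximal) f
    with Fin.any? (λ e → (e ∈? M) ×-dec meets? e f)
  ... | yes dom = dom
  ... | no ¬dom = contradiction (M ∪ ⁅ f ⁆ , extended , proper) maximal
    where
    proper : M ⊂ M ∪ ⁅ f ⁆
    proper = p⊆p∪q ⁅ f ⁆ , f , q⊆p∪q M ⁅ f ⁆ (x∈⁅x⁆ f) , λ f∈M → ¬dom (f , f∈M , meets-refl f)

    extended : IsMatching G (M ∪ ⁅ f ⁆)
    extended e e∈ g g∈ v ve vg with x∈p∪q⁻ M ⁅ f ⁆ e∈ | x∈p∪q⁻ M ⁅ f ⁆ g∈
    ... | inj₁ e∈M | inj₁ g∈M = matching e e∈M g g∈M v ve vg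
    ... | inj₁ e∈M | inj₂ g∈f with refl ← x∈⁅y⁆⇒x≡y f g∈f = contradiction (e , e∈M , v , ve , vg) ¬dom
    ... | inj₂ e∈f | inj₁ g∈M with refl ← x∈⁅y⁆⇒x≡y f e∈f = contradiction (g , g∈M , v , vg , ve) ¬dom
    ... | inj₂ e∈f | inj₂ g∈f = trans (x∈⁅y⁆⇒x≡y f e∈f) (sym (x∈⁅y⁆⇒x≡y f g∈f))

  maximalMatchings-unique : Unique (maximalMatchings G)
  maximalMatchings-unique = Unique.filter⁺ (isMaximalMatching? G) (allSubsets-unique (size G))

  ∈-maximalMatchings⁻ : ∀ {M} → M List.∈ maximalMatchings G → IsMaximalMatching G M
  ∈-maximalMatchings⁻ M∈ = proj₂ (∈-filter⁻ (isMaximalMatching? G) {xs = allSubsets (size G)} M∈)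

  ∈-maximalMatchings⁺ : ∀ {M} → IsMaximalMatching G M → M List.∈ maximalMatchings G
  ∈-maximalMatchings⁺ {M} = ∈-filter⁺ (isMaximalMatching? G) (∈-allSubsets M)

  opaque
    -- Numerator and denominator of `avm`, kept opaque so that later arithmetic treats them as bare
    -- numbers rather than as enumerations of all edge sets.
    sumSizes count : ℕ
    sumSizes = sum (map ∣_∣ (maximalMatchings G))
    count = length (maximalMatchings G)

  two-elements : ∀ {M : EdgeSet G} {e f} → e ∈ M → f ∈ M → e ≢ f → 2 ℕ.≤ ∣ M ∣
  two-elements {M} {e} {f} e∈M f∈M e≢f = subst (ℕ._≤ ∣ M ∣) (∣⁅x⁆∪⁅y⁆∣≡2 e≢f) (p⊆q⇒∣p∣≤∣q∣ pair⊆M)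
    where
    pair⊆M : ∀ {g} → g ∈ ⁅ e ⁆ ∪ ⁅ f ⁆ → g ∈ M
    pair⊆M g∈ with x∈p∪q⁻ ⁅ e ⁆ ⁅ f ⁆ g∈
    ... | inj₁ p with refl ← x∈⁅y⁆⇒x≡y e p = e∈M
    ... | inj₂ p with refl ← x∈⁅y⁆⇒x≡y f p = f∈M

  opaque
    unfolding sumSizes count

    -- A member `e` of a maximal matching misses some edge `f`, which must then be met by a second
    -- member. The edge `e₀` ensures that there is a first member.
    sumSizes-≥ : Edge → (∀ e → ∃[ f ] ¬ Meets e f) → count * 2 ℕ.≤ sumSizes
    sumSizes-≥ e₀ apart = sum-map-≥ ∣_∣ 2 (All.tabulate (λ M∈ → large (∈-maximalMatchings⁻ M∈)))
      where
      large : ∀ {M} → IsMaximalMatching G M → 2 ℕ.≤ ∣ M ∣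
      large max =
        let e , e∈M , _ = maximal⇒dominating max e₀
            f , e≁f = apart e
            g , g∈M , g~f = maximal⇒dominating max f
        in two-elements e∈M g∈M λ e≡g → e≁f (subst (λ h → Meets h f) (sym e≡g) g~f)

-- Edges that meet every edge: degrees and sizes

-- In a connected graph `dominates` follows from `covers`. As a field it can be checked directly for
-- θ and carried along isomorphisms.
record EdgeCover {n} (G : Graph n) (a b : Fin n) : Set where
  field
    a~b        : Adj G a b
    covers     : ∀ {i j} → Adj G i j → (i ≡ a ⊎ i ≡ b) ⊎ (j ≡ a ⊎ j ≡ b)
    dominates  : ∀ {v} → v ≢ a → v ≢ b → Adj G a v ⊎ Adj G b v

  a≢b : a ≢ b
  a≢b = Adj⇒≢ G a~b

open EdgeCover

EdgeCover-sym : ∀ {n} {G : Graph n} {a b} → EdgeCover G a b → EdgeCover G b a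
EdgeCover-sym {G = G} cov = record
  { a~b       = Adj-sym G (a~b cov)
  ; covers    = λ i~j → Sum.map Sum.swap Sum.swap (covers cov i~j)
  ; dominates = λ v≢b v≢a → Sum.swap (dominates cov v≢a v≢b)
  }

module _ {n} (G : Graph n) where
  open Graph G using (adj; Edge; Incident)

  OtherNeighbour : (a b v : Fin n) → Set
  OtherNeighbour a b v = Adj G a v × v ≢ b

  otherNeighbour? : ∀ a b → Decidable (OtherNeighbour a b)
  otherNeighbour? a b v = T? (adj a v) ×-dec ¬? (v Fin.≟ b)

  otherNeighbours : (a b : Fin n) → List (Fin n)
  otherNeighbours a b = filter (otherNeighbour? a b) (allFin n)

  commonNeighbour? : ∀ a b → Decidable (λ v → OtherNeighbour a b v × OtherNeighbour b a v)
  commonNeighbour? a b v = otherNeighbour? a b v ×-dec otherNeighbour? b a v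

  commonNeighbours : (a b : Fin n) → List (Fin n)
  commonNeighbours a b = filter (commonNeighbour? a b) (allFin n)

  otherNeighbours-unique : ∀ a b → Unique (otherNeighbours a b)
  otherNeighbours-unique a b = Unique.filter⁺ (otherNeighbour? a b) (Unique.allFin⁺ n)

  commonNeighbours-unique : ∀ a b → Unique (commonNeighbours a b)
  commonNeighbours-unique a b = Unique.filter⁺ (commonNeighbour? a b) (Unique.allFin⁺ n)

  ∈-otherNeighbours⁺ : ∀ {a b v} → OtherNeighbour a b v → v List.∈ otherNeighbours a b
  ∈-otherNeighbours⁺ {a} {b} {v} = ∈-filter⁺ (otherNeighbour? a b) (∈-allFin v)

  ∈-otherNeighbours⁻ : ∀ {a b v} → v List.∈ otherNeighbours a b → OtherNeighbour a b v
  ∈-otherNeighbours⁻ {a} {b} v∈ = proj₂ (∈-filter⁻ (otherNeighbour? a b) {xs = allFin n} v∈)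

  ∈-commonNeighbours⁺ : ∀ {a b v} → OtherNeighbour a b v → OtherNeighbour b a v → v List.∈ commonNeighbours a b
  ∈-commonNeighbours⁺ {a} {b} {v} p q = ∈-filter⁺ (commonNeighbour? a b) (∈-allFin v) (p , q)

  ∈-commonNeighbours⁻ : ∀ {a b v} → v List.∈ commonNeighbours a b → OtherNeighbour a b v × OtherNeighbour b a v
  ∈-commonNeighbours⁻ {a} {b} v∈ = proj₂ (∈-filter⁻ (commonNeighbour? a b) {xs = allFin n} v∈)

  -- For adjacent `a` and `b` this is the degree of `a` less one, the edge `ab` being left out.
  deg : (a b : Fin n) → ℕ
  deg a b = length (otherNeighbours a b)

  codeg : (a b : Fin n) → ℕ
  codeg a b = length (commonNeighbours a b)

  module _ {a b} (cov : EdgeCover G a b) where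

    private
      either? : Decidable (λ v → OtherNeighbour a b v ⊎ OtherNeighbour b a v)
      either? v = otherNeighbour? a b v ⊎-dec otherNeighbour? b a v

      eithers : List (Fin n)
      eithers = filter either? (allFin n)

      either⇒≢ : ∀ {v} → v List.∈ eithers → a ≢ v × b ≢ v
      either⇒≢ v∈ with proj₂ (∈-filter⁻ either? {xs = allFin n} v∈)
      ... | inj₁ (a~v , v≢b) = Adj⇒≢ G a~v , v≢b ∘ sym
      ... | inj₂ (b~v , v≢a) = v≢a ∘ sym , Adj⇒≢ G b~v

      vertices-↭ : allFin n ↭ a ∷ b ∷ eithers
      vertices-↭ = unique-↭ (Unique.allFin⁺ n)
        ((a≢b cov ∷ All.tabulate (proj₁ ∘ either⇒≢)) ∷ All.tabulate (proj₂ ∘ either⇒≢)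
          ∷ Unique.filter⁺ either? (Unique.allFin⁺ n))
        (λ {v} _ → complete v) (λ {v} _ → ∈-allFin v)
        where
        complete : ∀ v → v List.∈ a ∷ b ∷ eithers
        complete v with v Fin.≟ a | v Fin.≟ b
        ... | yes v≡a | _       = here v≡a
        ... | no _    | yes v≡b = there (here v≡b)
        ... | no v≢a  | no v≢b  = there (there (∈-filter⁺ either? (∈-allFin v)
          (Sum.map (_, v≢b) (_, v≢a) (dominates cov v≢a v≢b))))

    -- By `dominates` every vertex other than `a` and `b` is a neighbour of one of them; the common
    -- neighbours are counted twice.
    deg+deg : 2 + (deg a b + deg b a) ≡ n + codeg a b
    deg+deg = trans (cong (2 +_) (length-filter-⊎-× (otherNeighbour? a b) (otherNeighbour? b a) (allFin n)))
      (cong (_+ codeg a b) (trans (sym (↭-length vertices-↭)) (length-tabulate id)))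

    ab : Edge
    ab = proj₁ (link-exists G (a~b cov))

    a∈ab : Incident a ab
    a∈ab = proj₁ (proj₂ (link-exists G (a~b cov)))

    b∈ab : Incident b ab
    b∈ab = proj₂ (proj₂ (link-exists G (a~b cov)))

    -- The junk value for non-adjacent i and j is ab.
    link : Fin n → Fin n → Edge
    link i j with Fin.any? (λ e → incident? G i e ×-dec incident? G j e)
    ... | yes (e , _) = e
    ... | no _        = ab

    link-links : ∀ {i j} → Adj G i j → Links G i j (link i j)
    link-links {i} {j} i~j with Fin.any? (λ e → incident? G i e ×-dec incident? G j e)
    ... | yes (_ , links) = links
    ... | no ¬links       = contradiction (link-exists G i~j) ¬links

    ∈-link : ∀ {i j k} → Adj G i j → Incident k (link i j) → k ≡ i ⊎ k ≡ j
    ∈-link i~j = let i∈ , j∈ = link-links i~j in incident-third G (Adj⇒≢ G i~j) i∈ j∈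

    link-injective : ∀ {i j k} → Adj G i j → Adj G i k → link i j ≡ link i k → j ≡ k
    link-injective i~j i~k eq with ∈-link i~k (subst (Incident _) eq (proj₂ (link-links i~j)))
    ... | inj₁ j≡i = contradiction (sym j≡i) (Adj⇒≢ G i~j)
    ... | inj₂ j≡k = j≡k

    edge-meets : ∀ e → Incident a e ⊎ Incident b e
    edge-meets e with covers cov (proj₂ (edge-ends G e))
    ... | inj₁ (inj₁ refl) = inj₁ (inj₁ refl)
    ... | inj₁ (inj₂ refl) = inj₂ (inj₁ refl)
    ... | inj₂ (inj₁ refl) = inj₁ (inj₂ refl)
    ... | inj₂ (inj₂ refl) = inj₂ (inj₂ refl)

    edge-at-a : ∀ {e} → Incident a e → e ≡ ab ⊎ ∃[ x ] OtherNeighbour a b x × Incident x e × e ≡ link a x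
    edge-at-a {e} ae with x , a≢x , xe ← otherEnd G ae with x Fin.≟ b
    ... | yes refl = inj₁ (link-unique G a≢x (ae , xe) (a∈ab , b∈ab))
    ... | no x≢b   = let a~x = incident-adj G a≢x ae xe in
                     inj₂ (x , (a~x , x≢b) , xe , link-unique G a≢x (ae , xe) (link-links a~x))

    edge-at-b : ∀ {e} → Incident b e → e ≡ ab ⊎ ∃[ y ] OtherNeighbour b a y × Incident y e × e ≡ link b y
    edge-at-b {e} be with y , b≢y , ye ← otherEnd G be with y Fin.≟ a
    ... | yes refl = inj₁ (link-unique G (b≢y ∘ sym) (ye , be) (a∈ab , b∈ab))
    ... | no y≢a   = let b~y = incident-adj G b≢y be ye in
                     inj₂ (y , (b~y , y≢a) , ye , link-unique G b≢y (be , ye) (link-links b~y))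

    a∉link-b : ∀ {y} → OtherNeighbour b a y → ¬ Incident a (link b y)
    a∉link-b (b~y , y≢a) a∈ = [ a≢b cov , y≢a ∘ sym ]′ (∈-link b~y a∈)

    b∉link-a : ∀ {x} → OtherNeighbour a b x → ¬ Incident b (link a x)
    b∉link-a (a~x , x≢b) b∈ = [ a≢b cov ∘ sym , x≢b ∘ sym ]′ (∈-link a~x b∈)

    link-a≢link-b : ∀ {x y} → OtherNeighbour a b x → OtherNeighbour b a y → link a x ≢ link b y
    link-a≢link-b (a~x , _) by eq = a∉link-b by (subst (Incident a) eq (proj₁ (link-links a~x)))

    private
      atA atB : List Edge
      atA = map (link a) (otherNeighbours a b)
      atB = map (link b) (otherNeighbours b a)

      edges-↭ : allFin (size G) ↭ ab ∷ atA ++ atB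
      edges-↭ = unique-↭ (Unique.allFin⁺ _) (All.tabulate fresh ∷ Unique.++⁺ (unique-map (link a)
            (λ p q → link-injective (proj₁ p) (proj₁ q)) (all-filter (otherNeighbour? a b) (allFin n)) (otherNeighbours-unique a b))
          (unique-map (link b)
            (λ p q → link-injective (proj₁ p) (proj₁ q)) (all-filter (otherNeighbour? b a) (allFin n)) (otherNeighbours-unique b a))
          (λ (p , q) → disjoint (∈-map⁻ (link a) p) (∈-map⁻ (link b) q)))
        (λ {e} _ → complete e) (λ {e} _ → ∈-allFin e)
        where
        disjoint : ∀ {e} → (∃[ x ] x List.∈ otherNeighbours a b × e ≡ link a x) →
                   ¬ (∃[ y ] y List.∈ otherNeighbours b a × e ≡ link b y)
        disjoint (_ , x∈ , refl) (_ , y∈ , eq) =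
          link-a≢link-b (∈-otherNeighbours⁻ x∈) (∈-otherNeighbours⁻ y∈) eq

        fresh : ∀ {e} → e List.∈ atA ++ atB → ab ≢ e
        fresh e∈ refl with ∈-++⁻ atA e∈
        ... | inj₁ p with _ , x∈ , eq ← ∈-map⁻ (link a) p =
          b∉link-a (∈-otherNeighbours⁻ x∈) (subst (Incident b) eq b∈ab)
        ... | inj₂ p with _ , y∈ , eq ← ∈-map⁻ (link b) p =
          a∉link-b (∈-otherNeighbours⁻ y∈) (subst (Incident a) eq a∈ab)

        complete : ∀ e → e List.∈ ab ∷ atA ++ atB
        complete e with edge-meets e
        ... | inj₁ ae with edge-at-a ae
        ...   | inj₁ e≡ab = here e≡ab
        ...   | inj₂ (x , ax , _ , refl) = there (∈-++⁺ˡ (∈-map⁺ (link a) (∈-otherNeighbours⁺ ax)))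
        complete e | inj₂ be with edge-at-b be
        ...   | inj₁ e≡ab = here e≡ab
        ...   | inj₂ (y , by , _ , refl) = there (∈-++⁺ʳ atA (∈-map⁺ (link b) (∈-otherNeighbours⁺ by)))

    -- Since `ab` meets every edge, the edges split into `ab`, those at `a` only and those at `b`
    -- only.
    size≡1+deg+deg : size G ≡ suc (deg a b + deg b a)
    size≡1+deg+deg = begin
      size G                      ≡⟨ length-tabulate id ⟨
      length (allFin (size G))    ≡⟨ ↭-length edges-↭ ⟩
      suc (length (atA ++ atB))   ≡⟨ cong suc (length-++ atA) ⟩
      suc (length atA + length atB)
        ≡⟨ cong suc (cong₂ _+_ (length-map (link a) (otherNeighbours a b)) (length-map (link b) (otherNeighbours b a))) ⟩
      suc (deg a b + deg b a)     ∎
      where open ≡-Reasoning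

    distinct? : Decidable (λ (p : Fin n × Fin n) → ¬ (proj₁ p ≡ proj₂ p))
    distinct? (x , y) = ¬? (x Fin.≟ y)

    -- The disjointness is that of the edges ax and by, which share a vertex exactly when x = y.
    disjointPairs : List (Fin n × Fin n)
    disjointPairs = filter distinct? (cartesianProduct (otherNeighbours a b) (otherNeighbours b a))

    private
      pairs : List (Fin n × Fin n)
      pairs = cartesianProduct (otherNeighbours a b) (otherNeighbours b a)

      equal? : Decidable (λ (p : Fin n × Fin n) → proj₁ p ≡ proj₂ p)
      equal? (x , y) = x Fin.≟ y

      pairs-unique : Unique pairs
      pairs-unique = Unique.cartesianProduct⁺ (otherNeighbours-unique a b) (otherNeighbours-unique b a)

      equalPairs-↭ : filter equal? pairs ↭ map (λ v → v , v) (commonNeighbours a b)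
      equalPairs-↭ = unique-↭ (Unique.filter⁺ equal? pairs-unique)
        (Unique.map⁺ (cong proj₁) (commonNeighbours-unique a b)) to from
        where
        to : ∀ {p} → p List.∈ filter equal? pairs → p List.∈ map (λ v → v , v) (commonNeighbours a b)
        to {x , y} p∈ with p∈pairs , refl ← ∈-filter⁻ equal? {xs = pairs} p∈
          with x∈ , y∈ ← ∈-cartesianProduct⁻ (otherNeighbours a b) (otherNeighbours b a) p∈pairs =
          ∈-map⁺ (λ v → v , v) (∈-commonNeighbours⁺ (∈-otherNeighbours⁻ x∈) (∈-otherNeighbours⁻ y∈))

        from : ∀ {p} → p List.∈ map (λ v → v , v) (commonNeighbours a b) → p List.∈ filter equal? pairs
        from p∈ with v , v∈ , refl ← ∈-map⁻ (λ v → v , v) p∈ =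
          let av , bv = ∈-commonNeighbours⁻ v∈ in
          ∈-filter⁺ equal? (∈-cartesianProduct⁺ (∈-otherNeighbours⁺ av) (∈-otherNeighbours⁺ bv)) refl

    ∈-disjointPairs⁻ : ∀ {x y} → (x , y) List.∈ disjointPairs →
                       OtherNeighbour a b x × OtherNeighbour b a y × x ≢ y
    ∈-disjointPairs⁻ p∈ =
      let p∈pairs , x≢y = ∈-filter⁻ distinct? {xs = pairs} p∈
          x∈ , y∈ = ∈-cartesianProduct⁻ (otherNeighbours a b) (otherNeighbours b a) p∈pairs
      in ∈-otherNeighbours⁻ x∈ , ∈-otherNeighbours⁻ y∈ , x≢y

    -- The discarded pairs form the diagonal, which is a copy of the common neighbours.
    length-disjointPairs : length disjointPairs + codeg a b ≡ deg a b * deg b a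
    length-disjointPairs = begin
      length disjointPairs + codeg a b
        ≡⟨ cong (length disjointPairs +_) (length-map (λ v → v , v) (commonNeighbours a b)) ⟨
      length disjointPairs + length (map (λ v → v , v) (commonNeighbours a b))
        ≡⟨ cong (length disjointPairs +_) (↭-length equalPairs-↭) ⟨
      length disjointPairs + length (filter equal? pairs)
        ≡⟨ length-filter-¬ equal? pairs ⟩
      length pairs
        ≡⟨ length-cartesianProduct (otherNeighbours a b) (otherNeighbours b a) ⟩
      deg a b * deg b a ∎
      where open ≡-Reasoning

    pairMatching : Fin n × Fin n → EdgeSet G
    pairMatching (x , y) = ⁅ link a x ⁆ ∪ ⁅ link b y ⁆

    singleton-maximal : IsMaximalMatching G ⁅ ab ⁆
    singleton-maximal = dominating⇒maximal G
      (λ e e∈ f f∈ _ _ _ → trans (x∈⁅y⁆⇒x≡y ab e∈) (sym (x∈⁅y⁆⇒x≡y ab f∈)))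
      (λ f → ab , x∈⁅x⁆ ab , [ (λ af → a , a∈ab , af) , (λ bf → b , b∈ab , bf) ]′ (edge-meets f))

    -- Every edge contains `a` or `b`, and both are saturated here, so nothing can be added.
    pair-maximal : ∀ {x y} → OtherNeighbour a b x → OtherNeighbour b a y → x ≢ y →
                   IsMaximalMatching G (pairMatching (x , y))
    pair-maximal {x} {y} ax@(a~x , x≢b) by@(b~y , y≢a) x≢y = dominating⇒maximal G matching dom
      where
      e₁ = link a x
      e₂ = link b y

      apart : ∀ {v} → Incident v e₁ → ¬ Incident v e₂
      apart v₁ v₂ with ∈-link a~x v₁
      ... | inj₁ refl = a∉link-b by v₂
      ... | inj₂ refl = [ x≢b , x≢y ]′ (∈-link b~y v₂)

      matching : IsMatching G (pairMatching (x , y))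
      matching e e∈ f f∈ v ve vf with x∈p∪q⁻ ⁅ e₁ ⁆ ⁅ e₂ ⁆ e∈ | x∈p∪q⁻ ⁅ e₁ ⁆ ⁅ e₂ ⁆ f∈
      ... | inj₁ p | inj₁ q = trans (x∈⁅y⁆⇒x≡y e₁ p) (sym (x∈⁅y⁆⇒x≡y e₁ q))
      ... | inj₂ p | inj₂ q = trans (x∈⁅y⁆⇒x≡y e₂ p) (sym (x∈⁅y⁆⇒x≡y e₂ q))
      ... | inj₁ p | inj₂ q with refl ← x∈⁅y⁆⇒x≡y e₁ p | refl ← x∈⁅y⁆⇒x≡y e₂ q = contradiction vf (apart ve)
      ... | inj₂ p | inj₁ q with refl ← x∈⁅y⁆⇒x≡y e₂ p | refl ← x∈⁅y⁆⇒x≡y e₁ q = contradiction ve (apart vf)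

      dom : ∀ f → Dominates G (pairMatching (x , y)) f
      dom f with edge-meets f
      ... | inj₁ af = e₁ , x∈p∪q⁺ (inj₁ (x∈⁅x⁆ e₁)) , a , proj₁ (link-links a~x) , af
      ... | inj₂ bf = e₂ , x∈p∪q⁺ (inj₂ (x∈⁅x⁆ e₂)) , b , proj₁ (link-links b~y) , bf

  -- Classification and count of the maximal matchings

  Saturates : EdgeSet G → Fin n → Set
  Saturates M v = ∃[ e ] e ∈ M × Incident v e

  -- If only b were saturated, by an edge bw, then the edge from a to a
  -- neighbour other than w and b could be added.
  saturates-a : ∀ {a b c d M} → EdgeCover G a b → c ≢ d → OtherNeighbour a b c → OtherNeighbour a b d →
                IsMaximalMatching G M → Saturates M a
  saturates-a {a} {b} {c} {d} {M} cov c≢d ac ad max@(matching , _)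
    with e , e∈M , v , ve , vab ← maximal⇒dominating G max (ab cov)
    with incident-third G (a≢b cov) (a∈ab cov) (b∈ab cov) vab
  ... | inj₁ refl = e , e∈M , ve
  ... | inj₂ refl with w , b≢w , we ← otherEnd G ve = [ via ac , via ad ]′ other
    where
    other : c ≢ w ⊎ d ≢ w
    other with c Fin.≟ w
    ... | yes refl = inj₂ (c≢d ∘ sym)
    ... | no c≢w   = inj₁ c≢w

    via : ∀ {z} → OtherNeighbour a b z → z ≢ w → Saturates M a
    via {z} (a~z , z≢b) z≢w
      with g , g∈M , u , ug , uaz ← maximal⇒dominating G max (link cov a z)
      with ∈-link cov a~z uaz | edge-meets cov g
    ... | inj₁ refl | _       = g , g∈M , ug
    ... | inj₂ refl | inj₁ ag = g , g∈M , ag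
    ... | inj₂ refl | inj₂ bg with refl ← matching g g∈M e e∈M b bg ve =
      contradiction (incident-third G b≢w ve we ug) [ z≢b , z≢w ]′

  module _ {a b c d} (cov : EdgeCover G a b) (c≢d : c ≢ d)
           (ac : OtherNeighbour a b c) (bc : OtherNeighbour b a c)
           (ad : OtherNeighbour a b d) (bd : OtherNeighbour b a d) where

    private
      Standard : EdgeSet G → Set
      Standard M = M ≡ ⁅ ab cov ⁆ ⊎ ∃[ x ] ∃[ y ] OtherNeighbour a b x × OtherNeighbour b a y × x ≢ y ×
                                                  M ≡ pairMatching cov (x , y)

      -- Both `a` and `b` are saturated, and every edge contains one of them, so `M` consists of
      -- just the edge saturating `a` and the edge saturating `b`, which may coincide.
      classify : ∀ {M} → IsMaximalMatching G M → Standard M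
      classify {M} max@(matching , _)
        with e , e∈M , ae ← saturates-a cov c≢d ac ad max
        with f , f∈M , bf ← saturates-a (EdgeCover-sym cov) c≢d bc bd max
        with edge-at-a cov ae | edge-at-b cov bf
      ... | inj₁ refl | _ = inj₁ (⊆-antisym to from)
        where
        to : ∀ {g} → g ∈ M → g ∈ ⁅ ab cov ⁆
        to {g} g∈M with edge-meets cov g
        ... | inj₁ ag with refl ← matching g g∈M e e∈M a ag ae = x∈⁅x⁆ _
        ... | inj₂ bg with refl ← matching g g∈M e e∈M b bg (b∈ab cov) = x∈⁅x⁆ _

        from : ∀ {g} → g ∈ ⁅ ab cov ⁆ → g ∈ M
        from g∈ with refl ← x∈⁅y⁆⇒x≡y (ab cov) g∈ = e∈M
      -- Here `ab` and `link a x` both lie in the matching and share `a`, so they would coincide,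
      -- although `link a x` avoids `b`.
      ... | inj₂ (x , ax , _ , refl) | inj₁ refl =
        contradiction (subst (Incident b) (matching _ f∈M _ e∈M a (a∈ab cov) ae) (b∈ab cov)) (b∉link-a cov ax)
      ... | inj₂ (x , ax , xe , refl) | inj₂ (y , by , yf , refl) =
        inj₂ (x , y , ax , by , (λ { refl → link-a≢link-b cov ax by (matching _ e∈M _ f∈M x xe yf) }) , ⊆-antisym to from)
        where
        to : ∀ {g} → g ∈ M → g ∈ pairMatching cov (x , y)
        to {g} g∈M with edge-meets cov g
        ... | inj₁ ag with refl ← matching g g∈M e e∈M a ag ae = x∈p∪q⁺ (inj₁ (x∈⁅x⁆ _))
        ... | inj₂ bg with refl ← matching g g∈M f f∈M b bg bf = x∈p∪q⁺ (inj₂ (x∈⁅x⁆ _))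

        from : ∀ {g} → g ∈ pairMatching cov (x , y) → g ∈ M
        from g∈ with x∈p∪q⁻ ⁅ e ⁆ ⁅ f ⁆ g∈
        ... | inj₁ p with refl ← x∈⁅y⁆⇒x≡y e p = e∈M
        ... | inj₂ p with refl ← x∈⁅y⁆⇒x≡y f p = f∈M

      GoodPair : Fin n × Fin n → Set
      GoodPair (x , y) = OtherNeighbour a b x × OtherNeighbour b a y × x ≢ y

      goodPairs : All GoodPair (disjointPairs cov)
      goodPairs = All.tabulate (∈-disjointPairs⁻ cov)

      pairMatching-injective : ∀ {p q} → GoodPair p → GoodPair q →
                               pairMatching cov p ≡ pairMatching cov q → p ≡ q
      pairMatching-injective {x , y} {x′ , y′} (ax , by , _) (ax′ , by′ , _) eq = cong₂ _,_ x≡x′ y≡y′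
        where
        x≡x′ : x ≡ x′
        x≡x′ with x∈p∪q⁻ ⁅ link cov a x′ ⁆ ⁅ link cov b y′ ⁆ (subst (link cov a x ∈_) eq (x∈p∪q⁺ (inj₁ (x∈⁅x⁆ _))))
        ... | inj₁ p = link-injective cov (proj₁ ax) (proj₁ ax′) (x∈⁅y⁆⇒x≡y _ p)
        ... | inj₂ p = contradiction (x∈⁅y⁆⇒x≡y _ p) (link-a≢link-b cov ax by′)

        y≡y′ : y ≡ y′
        y≡y′ with x∈p∪q⁻ ⁅ link cov a x′ ⁆ ⁅ link cov b y′ ⁆ (subst (link cov b y ∈_) eq (x∈p∪q⁺ (inj₂ (x∈⁅x⁆ _))))
        ... | inj₁ p = contradiction (sym (x∈⁅y⁆⇒x≡y _ p)) (link-a≢link-b cov ax′ by)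
        ... | inj₂ p = link-injective cov (proj₁ by) (proj₁ by′) (x∈⁅y⁆⇒x≡y _ p)

    maximalMatchings-↭ : maximalMatchings G ↭ ⁅ ab cov ⁆ ∷ map (pairMatching cov) (disjointPairs cov)
    maximalMatchings-↭ = unique-↭ (maximalMatchings-unique G)
      (All-map⁺ (All.map fresh goodPairs) ∷ unique-map (pairMatching cov) pairMatching-injective goodPairs
        (Unique.filter⁺ (distinct? cov) (Unique.cartesianProduct⁺ (otherNeighbours-unique a b) (otherNeighbours-unique b a))))
      to from
      where
      fresh : ∀ {p} → GoodPair p → ⁅ ab cov ⁆ ≢ pairMatching cov p
      fresh {x , _} (ax , _) eq = b∉link-a cov ax (subst (Incident b) (sym link≡ab) (b∈ab cov))
        where
        link≡ab : link cov a x ≡ ab cov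
        link≡ab = x∈⁅y⁆⇒x≡y (ab cov) (subst (link cov a x ∈_) (sym eq) (x∈p∪q⁺ (inj₁ (x∈⁅x⁆ _))))

      place : ∀ {M} → Standard M → M List.∈ ⁅ ab cov ⁆ ∷ map (pairMatching cov) (disjointPairs cov)
      place (inj₁ M≡) = here M≡
      place (inj₂ (x , y , ax , by , x≢y , refl)) = there (∈-map⁺ (pairMatching cov)
        (∈-filter⁺ (distinct? cov) (∈-cartesianProduct⁺ (∈-otherNeighbours⁺ ax) (∈-otherNeighbours⁺ by)) x≢y))

      to : ∀ {M} → M List.∈ maximalMatchings G → M List.∈ ⁅ ab cov ⁆ ∷ map (pairMatching cov) (disjointPairs cov)
      to M∈ = place (classify (∈-maximalMatchings⁻ G M∈))

      from : ∀ {M} → M List.∈ ⁅ ab cov ⁆ ∷ map (pairMatching cov) (disjointPairs cov) → M List.∈ maximalMatchings G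
      from (here refl) = ∈-maximalMatchings⁺ G (singleton-maximal cov)
      from (there M∈) = All.lookup
        (All-map⁺ (All.map (λ (ax , by , x≢y) → ∈-maximalMatchings⁺ G (pair-maximal cov ax by x≢y)) goodPairs)) M∈

    opaque
      unfolding count

      count≡1+disjointPairs : count G ≡ suc (length (disjointPairs cov))
      count≡1+disjointPairs = trans (↭-length maximalMatchings-↭) (cong suc (length-map (pairMatching cov) (disjointPairs cov)))

    -- The 1 is the matching consisting of `ab`; the product counts pairs of edges at `a` and `b`,
    -- and `codeg` those that meet outside `a` and `b`.
    count+codeg : count G + codeg a b ≡ suc (deg a b * deg b a)
    count+codeg = trans (cong (_+ codeg a b) count≡1+disjointPairs) (cong suc (length-disjointPairs cov))

    opaque
      unfolding sumSizes count

      suc-sumSizes : suc (sumSizes G) ≡ count G * 2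
      suc-sumSizes = begin
        suc (sumSizes G)
          ≡⟨ cong suc (sum-↭ (↭-map⁺ ∣_∣ maximalMatchings-↭)) ⟩
        suc (∣ ⁅ ab cov ⁆ ∣ + sum (map ∣_∣ Ms))
          ≡⟨ cong₂ (λ i j → suc (i + j)) (∣⁅x⁆∣≡1 (ab cov)) (sum-map-const ∣_∣ 2 sizes) ⟩
        2 + length Ms * 2
          ≡⟨ cong (_* 2) (↭-length maximalMatchings-↭) ⟨
        count G * 2 ∎
        where
        open ≡-Reasoning

        Ms : List (EdgeSet G)
        Ms = map (pairMatching cov) (disjointPairs cov)

        sizes : All (λ M → ∣ M ∣ ≡ 2) Ms
        sizes = All-map⁺ (All.map (λ (ax , by , _) → ∣⁅x⁆∪⁅y⁆∣≡2 (link-a≢link-b cov ax by)) goodPairs)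

-- Leafy diamonds: θ described by labelled vertices

-- Here `a` is the vertex carrying the leaves, `ab` the edge shared by the triangles, `c` and `d`
-- their tips. That `c` and `d` are not adjacent follows from `covers`, and that all remaining
-- vertices are leaves at `a` from `covers`, `dominates` and `b-neighbours`.
record LeafyDiamond {n} (G : Graph n) (a b c d : Fin n) : Set where
  field
    cover        : EdgeCover G a b
    c≢d          : c ≢ d
    a~c          : Adj G a c
    b~c          : Adj G b c
    a~d          : Adj G a d
    b~d          : Adj G b d
    b-neighbours : ∀ {v} → Adj G b v → v ≡ a ⊎ v ≡ c ⊎ v ≡ d

  ac : OtherNeighbour G a b c
  ac = a~c , Adj⇒≢ G b~c ∘ sym

  bc : OtherNeighbour G b a c
  bc = b~c , Adj⇒≢ G a~c ∘ sym

  ad : OtherNeighbour G a b d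
  ad = a~d , Adj⇒≢ G b~d ∘ sym

  bd : OtherNeighbour G b a d
  bd = b~d , Adj⇒≢ G a~d ∘ sym

module _ {n} {G : Graph n} {a b c d} (leafy : LeafyDiamond G a b c d) where
  open LeafyDiamond leafy
  open Graph G using (adj; adj-irrefl)

  private
    c-or-d : ∀ {v} → OtherNeighbour G b a v → v ≡ c ⊎ v ≡ d
    c-or-d (b~v , v≢a) with b-neighbours b~v
    ... | inj₁ v≡a = contradiction v≡a v≢a
    ... | inj₂ v≡  = v≡

    deg-b : deg G b a ≡ 2
    deg-b = length≡2 (otherNeighbours-unique G b a) (∈-otherNeighbours⁺ G bc) (∈-otherNeighbours⁺ G bd) c≢d
      (λ v∈ → c-or-d (∈-otherNeighbours⁻ G v∈))

    codeg-ab : codeg G a b ≡ 2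
    codeg-ab = length≡2 (commonNeighbours-unique G a b)
      (∈-commonNeighbours⁺ G ac bc) (∈-commonNeighbours⁺ G ad bd) c≢d
      (λ v∈ → c-or-d (proj₂ (∈-commonNeighbours⁻ G v∈)))

    deg-a : deg G a b + 2 ≡ n
    deg-a = ℕ.+-cancelˡ-≡ 2 _ _ (begin
      2 + (deg G a b + 2)         ≡⟨ cong (λ k → 2 + (deg G a b + k)) deg-b ⟨
      2 + (deg G a b + deg G b a) ≡⟨ deg+deg G cover ⟩
      n + codeg G a b             ≡⟨ cong (n +_) codeg-ab ⟩
      n + 2                       ≡⟨ ℕ.+-comm n 2 ⟩
      2 + n                       ∎)
      where open ≡-Reasoning

  leafy-sumSizes : suc (sumSizes G) ≡ count G * 2
  leafy-sumSizes = suc-sumSizes G cover c≢d ac bc ad bd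

  -- With 2 other neighbours at `b`, n - 2 at `a` and 2 in common, the count is 2(n - 2) - 2 + 1 =
  -- 2n - 5.
  leafy-count : count G + 5 ≡ n * 2
  leafy-count = begin
    count G + 5                         ≡⟨ ℕ.+-assoc (count G) 2 3 ⟨
    count G + 2 + 3                     ≡⟨ cong (λ k → count G + k + 3) codeg-ab ⟨
    count G + codeg G a b + 3           ≡⟨ cong (_+ 3) (count+codeg G cover c≢d ac bc ad bd) ⟩
    suc (deg G a b * deg G b a) + 3     ≡⟨ cong (λ k → suc (deg G a b * k) + 3) deg-b ⟩
    suc (deg G a b * 2) + 3             ≡⟨ solve 1 (λ k → con 1 :+ k :* con 2 :+ con 3 := (k :+ con 2) :* con 2) refl (deg G a b) ⟩
    (deg G a b + 2) * 2                 ≡⟨ cong (_* 2) deg-a ⟩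
    n * 2                               ∎
    where
    open ≡-Reasoning
    open +-*-Solver

  private
    Leaf : Fin n → Set
    Leaf v = v ≢ a × v ≢ b × v ≢ c × v ≢ d

    leaf? : Decidable Leaf
    leaf? v = ¬? (v Fin.≟ a) ×-dec ¬? (v Fin.≟ b) ×-dec ¬? (v Fin.≟ c) ×-dec ¬? (v Fin.≟ d)

    -- The order is that of the vertices of θ: u, v, x, y, then the leaves. The position in `vs` is
    -- therefore the isomorphism.
    leaves vs : List (Fin n)
    leaves = filter leaf? (allFin n)
    vs = a ∷ b ∷ c ∷ d ∷ leaves

    leaf : ∀ k → Leaf (lookup leaves k)
    leaf k = All.lookup (all-filter leaf? (allFin n)) (∈-lookup k)

    vs-unique : Unique vs
    vs-unique =
      (Adj⇒≢ G (a~b cover) ∷ Adj⇒≢ G a~c ∷ Adj⇒≢ G a~d ∷ fresh (λ l → proj₁ l)) ∷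
      (Adj⇒≢ G b~c ∷ Adj⇒≢ G b~d ∷ fresh (λ l → proj₁ (proj₂ l))) ∷
      (c≢d ∷ fresh (λ l → proj₁ (proj₂ (proj₂ l)))) ∷
      fresh (λ l → proj₂ (proj₂ (proj₂ l))) ∷
      Unique.filter⁺ leaf? (Unique.allFin⁺ n)
      where
      fresh : ∀ {u} → (∀ {v} → Leaf v → v ≢ u) → All (u ≢_) leaves
      fresh ≢u = All.map (λ l → ≢u l ∘ sym) (all-filter leaf? (allFin n))

    vs-complete : ∀ v → v List.∈ vs
    vs-complete v with v Fin.≟ a | v Fin.≟ b | v Fin.≟ c | v Fin.≟ d
    ... | yes p | _     | _     | _     = here p
    ... | no _  | yes p | _     | _     = there (here p)
    ... | no _  | no _  | yes p | _     = there (there (here p))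
    ... | no _  | no _  | no _  | yes p = there (there (there (here p)))
    ... | no p  | no q  | no r  | no s  =
      there (there (there (there (∈-filter⁺ leaf? (∈-allFin v) (p , q , r , s)))))

    position : Fin n ↔ Fin (4 + length leaves)
    position = mk↔ₛ′ (λ v → index (vs-complete v)) (lookup vs)
      (λ k → lookup-injective vs-unique _ _ (sym (lookup-index (vs-complete (lookup vs k)))))
      (λ v → sym (lookup-index (vs-complete v)))

    T⇒true : ∀ {x} → T x → true ≡ x
    T⇒true {true} _ = refl

    ¬T⇒false : ∀ {x} → ¬ T x → false ≡ x
    ¬T⇒false {true}  ¬t = contradiction _ ¬t
    ¬T⇒false {false} _  = refl

    Outer : Fin n → Set
    Outer v = v ≢ a × v ≢ b

    outer-leaf : ∀ k → Outer (lookup leaves k)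
    outer-leaf k = let p , q , _ = leaf k in p , q

    c-outer : Outer c
    c-outer = proj₂ bc , proj₂ ac

    d-outer : Outer d
    d-outer = proj₂ bd , proj₂ ad

    outer-nonadj : ∀ {i j} → Outer i → Outer j → false ≡ adj i j
    outer-nonadj (i≢a , i≢b) (j≢a , j≢b) =
      ¬T⇒false λ i~j → [ [ i≢a , i≢b ]′ , [ j≢a , j≢b ]′ ]′ (covers cover i~j)

    b-leaf : ∀ k → ¬ Adj G b (lookup leaves k)
    b-leaf k b~v = let p , q , r , s = leaf k in [ p , [ r , s ]′ ]′ (b-neighbours b~v)

    -- By `dominates` the vertex is adjacent to `a` or `b`, and the neighbours of `b` are already
    -- used up.
    a-leaf : ∀ k → Adj G a (lookup leaves k)
    a-leaf k = let p , q , _ = leaf k in [ id , (λ b~v → contradiction b~v (b-leaf k)) ]′ (dominates cover p q)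

    adj-vs : ∀ i j → Graph.adj (attachLeaves diamond zero (length leaves)) i j ≡ adj (lookup vs i) (lookup vs j)
    adj-vs 0F 0F = sym (adj-irrefl a)
    adj-vs 0F 1F = T⇒true (a~b cover)
    adj-vs 0F 2F = T⇒true a~c
    adj-vs 0F 3F = T⇒true a~d
    adj-vs 0F (suc (suc (suc (suc j)))) = T⇒true (a-leaf j)
    adj-vs 1F 0F = T⇒true (Adj-sym G (a~b cover))
    adj-vs 1F 1F = sym (adj-irrefl b)
    adj-vs 1F 2F = T⇒true b~c
    adj-vs 1F 3F = T⇒true b~d
    adj-vs 1F (suc (suc (suc (suc j)))) = ¬T⇒false (b-leaf j)
    adj-vs 2F 0F = T⇒true (Adj-sym G a~c)
    adj-vs 2F 1F = T⇒true (Adj-sym G b~c)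
    adj-vs 2F 2F = outer-nonadj c-outer c-outer
    adj-vs 2F 3F = outer-nonadj c-outer d-outer
    adj-vs 2F (suc (suc (suc (suc j)))) = outer-nonadj c-outer (outer-leaf j)
    adj-vs 3F 0F = T⇒true (Adj-sym G a~d)
    adj-vs 3F 1F = T⇒true (Adj-sym G b~d)
    adj-vs 3F 2F = outer-nonadj d-outer c-outer
    adj-vs 3F 3F = outer-nonadj d-outer d-outer
    adj-vs 3F (suc (suc (suc (suc j)))) = outer-nonadj d-outer (outer-leaf j)
    adj-vs (suc (suc (suc (suc i)))) 0F = T⇒true (Adj-sym G (a-leaf i))
    adj-vs (suc (suc (suc (suc i)))) 1F = ¬T⇒false (b-leaf i ∘ Adj-sym G)
    adj-vs (suc (suc (suc (suc i)))) 2F = outer-nonadj (outer-leaf i) c-outer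
    adj-vs (suc (suc (suc (suc i)))) 3F = outer-nonadj (outer-leaf i) d-outer
    adj-vs (suc (suc (suc (suc i)))) (suc (suc (suc (suc j)))) = outer-nonadj (outer-leaf i) (outer-leaf j)

  leafy⇒≅θ : G ≅ θ¹₃₃ n
  -- The bijection `position` forces n = 4 + `length leaves`, so the number of leaves is n ∸ 4.
  leafy⇒≅θ = subst (λ k → G ≅ attachLeaves diamond zero k) (cong (_∸ 4) (sym (↔⇒≡ position))) (record
    { bijection = position
    ; preserves = λ i j → trans (adj-vs (Inverse.to position i) (Inverse.to position j))
        (sym (cong₂ adj (lookup-index (vs-complete i)) (lookup-index (vs-complete j))))
    })

θ-leafy : ∀ k → LeafyDiamond (attachLeaves diamond zero k) 0F 1F 2F 3F
θ-leafy k = record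
  { cover = record { a~b = _ ; covers = λ {i} {j} → θ-covers i j ; dominates = λ {v} → θ-dominates v }
  ; c≢d = λ () ; a~c = _ ; b~c = _ ; a~d = _ ; b~d = _
  ; b-neighbours = λ {v} → θ-b-neighbours v
  }
  where
  H = attachLeaves diamond zero k

  θ-covers : ∀ i j → Adj H i j → (i ≡ 0F ⊎ i ≡ 1F) ⊎ (j ≡ 0F ⊎ j ≡ 1F)
  θ-covers 0F _ _ = inj₁ (inj₁ refl)
  θ-covers 1F _ _ = inj₁ (inj₂ refl)
  θ-covers (suc (suc _)) 0F _ = inj₂ (inj₁ refl)
  θ-covers (suc (suc _)) 1F _ = inj₂ (inj₂ refl)
  θ-covers 2F 2F ()
  θ-covers 2F 3F ()
  θ-covers 2F (suc (suc (suc (suc _)))) ()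
  θ-covers 3F 2F ()
  θ-covers 3F 3F ()
  θ-covers 3F (suc (suc (suc (suc _)))) ()
  θ-covers (suc (suc (suc (suc _)))) 2F ()
  θ-covers (suc (suc (suc (suc _)))) 3F ()
  θ-covers (suc (suc (suc (suc _)))) (suc (suc (suc (suc _)))) ()

  θ-dominates : ∀ v → v ≢ 0F → v ≢ 1F → Adj H 0F v ⊎ Adj H 1F v
  θ-dominates 0F v≢a _ = contradiction refl v≢a
  θ-dominates 1F _ v≢b = contradiction refl v≢b
  θ-dominates 2F _ _ = inj₁ _
  θ-dominates 3F _ _ = inj₁ _
  θ-dominates (suc (suc (suc (suc _)))) _ _ = inj₁ _

  θ-b-neighbours : ∀ v → Adj H 1F v → v ≡ 0F ⊎ v ≡ 2F ⊎ v ≡ 3F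
  θ-b-neighbours 0F _ = inj₁ refl
  θ-b-neighbours 1F ()
  θ-b-neighbours 2F _ = inj₂ (inj₁ refl)
  θ-b-neighbours 3F _ = inj₂ (inj₂ refl)
  θ-b-neighbours (suc (suc (suc (suc _)))) ()

module _ {m n} {G : Graph m} {H : Graph n} (iso : G ≅ H) where
  open _≅_ iso
  open Inverse bijection

  private
    pull : ∀ {i j} → Adj H i j → Adj G (from i) (from j)
    pull {i} {j} i~j = subst T (preserves (from i) (from j))
      (subst₂ (Adj H) (sym (strictlyInverseˡ i)) (sym (strictlyInverseˡ j)) i~j)

    push : ∀ {i j} → Adj G i j → Adj H (to i) (to j)
    push = subst T (sym (preserves _ _))

    push-from : ∀ {i j} → Adj G (from i) j → Adj H i (to j)
    push-from i~j = subst (λ k → Adj H k _) (strictlyInverseˡ _) (push i~j)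

    pull-to : ∀ {i j} → Adj H i (to j) → Adj G (from i) j
    pull-to i~j = subst (Adj G _) (strictlyInverseʳ _) (pull i~j)

    back : ∀ {v a} → to v ≡ a → v ≡ from a
    back refl = sym (strictlyInverseʳ _)

    forth : ∀ {v a} → v ≢ from a → to v ≢ a
    forth v≢ to-v≡a = v≢ (back to-v≡a)

  -- Avoids carrying matchings along the isomorphism: once `G` is a leafy diamond itself,
  -- `leafy-sumSizes` and `leafy-count` determine its average.
  leafy-resp-≅ : ∀ {a b c d} → LeafyDiamond H a b c d → LeafyDiamond G (from a) (from b) (from c) (from d)
  leafy-resp-≅ leafy = record
    { cover = record
      { a~b       = pull (a~b cover)
      ; covers    = λ i~j → Sum.map (Sum.map back back) (Sum.map back back) (covers cover (push i~j))
      ; dominates = λ v≢a v≢b → Sum.map pull-to pull-to (dominates cover (forth v≢a) (forth v≢b))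
      }
    ; c≢d = λ eq → c≢d (trans (sym (strictlyInverseˡ _)) (trans (cong to eq) (strictlyInverseˡ _)))
    ; a~c = pull a~c ; b~c = pull b~c ; a~d = pull a~d ; b~d = pull b~d
    ; b-neighbours = λ b~v → Sum.map back (Sum.map back back) (b-neighbours (push-from b~v))
    }
    where open LeafyDiamond leafy

-- Connectivity and the covering edge

module _ {n} (G : Graph n) (connected : Connected G) where
  open Graph G using (edges; Edge)

  cover-from-edge : ∀ e → (∀ f → Meets G e f) → let (a , b) = lookup edges e in EdgeCover G a b
  cover-from-edge e meets = record { a~b = proj₂ (edge-ends G e) ; covers = covers′ ; dominates = dominates′ }
    where
    a = proj₁ (lookup edges e)
    b = proj₂ (lookup edges e)

    covers′ : ∀ {i j} → Adj G i j → (i ≡ a ⊎ i ≡ b) ⊎ (j ≡ a ⊎ j ≡ b)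
    covers′ i~j =
      let f , if , jf = link-exists G i~j
          v , ve , vf = meets f
          onEdge : ∀ {k} → v ≡ k → k ≡ a ⊎ k ≡ b
          onEdge v≡k = subst (λ k → k ≡ a ⊎ k ≡ b) v≡k ve
      in Sum.map onEdge onEdge (incident-third G (Adj⇒≢ G i~j) if jf vf)

    -- The first edge of a walk from `v` to `a` meets `ab`, but not in `v`, so it leads to `a` or
    -- `b`.
    first-step : ∀ {v} → v ≢ a → v ≢ b → Star (Adj G) v a → Adj G a v ⊎ Adj G b v
    first-step v≢a v≢b ε = contradiction refl v≢a
    first-step v≢a v≢b (v~w ◅ _) with covers′ v~w
    ... | inj₁ v∈          = contradiction v∈ [ v≢a , v≢b ]′
    ... | inj₂ (inj₁ refl) = inj₁ (Adj-sym G v~w)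
    ... | inj₂ (inj₂ refl) = inj₂ (Adj-sym G v~w)

    dominates′ : ∀ {v} → v ≢ a → v ≢ b → Adj G a v ⊎ Adj G b v
    dominates′ v≢a v≢b = first-step v≢a v≢b (connected _ a)

-- Comparing averages as fractions

-- Normalisation hides numerator and denominator, so the comparison passes to unnormalised
-- rationals, where the order is cross multiplication.
normalize-≤ : ∀ s n s′ n′ .{{_ : NonZero n}} .{{_ : NonZero n′}} →
              s * n′ ℕ.≤ s′ * n → ℤ.+ s / n ≤ ℤ.+ s′ / n′
normalize-≤ s (suc n) s′ (suc n′) le = ℚ.toℚᵘ-cancel-≤
  (ℚᵘ.≤-respˡ-≃ (ℚᵘ.≃-sym (ℚ.toℚᵘ-fromℚᵘ (mkℚᵘ (ℤ.+ s) n)))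
  (ℚᵘ.≤-respʳ-≃ (ℚᵘ.≃-sym (ℚ.toℚᵘ-fromℚᵘ (mkℚᵘ (ℤ.+ s′) n′)))
  (*≤* (subst₂ ℤ._≤_ (ℤ.pos-* s (suc n′)) (ℤ.pos-* s′ (suc n)) (ℤ.+≤+ le)))))

opaque
  unfolding count

  count-nonZero : ∀ {n} (G : Graph n) → NonZero (count G)
  count-nonZero = maximalMatchings-nonZero

module _ {m n} (G : Graph m) (H : Graph n) where
  private instance
    _ = maximalMatchings-nonZero G
    _ = maximalMatchings-nonZero H

  opaque
    unfolding sumSizes count

    avm-≤ : sumSizes G * count H ℕ.≤ sumSizes H * count G → avm G ≤ avm H
    avm-≤ = normalize-≤ (sumSizes G) (count G) (sumSizes H) (count H)

    avm-≡⁻ : avm G ≡ avm H → sumSizes G * count H ≡ sumSizes H * count G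
    avm-≡⁻ = ℚ.normalize-injective-≃ (sumSizes G) (sumSizes H) (count G) (count H)

    avm-≡⁺ : sumSizes G ≡ sumSizes H → count G ≡ count H → avm G ≡ avm H
    avm-≡⁺ s≡ c≡ = ℚ./-cong (cong ℤ.+_ s≡) c≡

≅θ⇒avm≡ : ∀ {n} (G : Graph n) → G ≅ θ¹₃₃ n → avm G ≡ avm (θ¹₃₃ n)
≅θ⇒avm≡ {n} G iso = avm-≡⁺ G (θ¹₃₃ n) (ℕ.suc-injective (begin
    suc (sumSizes G)          ≡⟨ leafy-sumSizes leafy-G ⟩
    count G * 2               ≡⟨ cong (_* 2) count≡ ⟩
    count (θ¹₃₃ n) * 2        ≡⟨ leafy-sumSizes (θ-leafy (n ∸ 4)) ⟨
    suc (sumSizes (θ¹₃₃ n))   ∎)) count≡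
  where
  open ≡-Reasoning
  leafy-G = leafy-resp-≅ iso (θ-leafy (n ∸ 4))

  count≡ : count G ≡ count (θ¹₃₃ n)
  count≡ = ℕ.+-cancelʳ-≡ 5 _ _ (begin
    count G + 5             ≡⟨ leafy-count leafy-G ⟩
    -- The isomorphism itself excludes n < 4, where θ would have more than n vertices.
    n * 2                   ≡⟨ cong (_* 2) (↔⇒≡ (_≅_.bijection iso)) ⟩
    (4 + (n ∸ 4)) * 2       ≡⟨ leafy-count (θ-leafy (n ∸ 4)) ⟨
    count (θ¹₃₃ n) + 5      ∎)

-- Both sides equal 2nn′. Consequently s/n ≤ s′/n′ holds exactly when n ≤ n′: the average grows with
-- the count.
cross-multiply : ∀ {s n s′ n′} → suc s ≡ n * 2 → suc s′ ≡ n′ * 2 → s * n′ + n′ ≡ s′ * n + n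
cross-multiply {s} {n} {s′} {n′} eq eq′ = begin
  s * n′ + n′   ≡⟨ ℕ.+-comm (s * n′) n′ ⟩
  suc s * n′    ≡⟨ cong (_* n′) eq ⟩
  n * 2 * n′    ≡⟨ solve 2 (λ n n′ → n :* con 2 :* n′ := n′ :* con 2 :* n) refl n n′ ⟩
  n′ * 2 * n    ≡⟨ cong (_* n) eq′ ⟨
  suc s′ * n    ≡⟨ ℕ.+-comm n (s′ * n) ⟩
  s′ * n + n    ∎
  where
  open ≡-Reasoning
  open +-*-Solver

-- The two cases of the theorem

Conclusion : ∀ {n} → Graph n → Set
Conclusion {n} G = (avm (θ¹₃₃ n) ≤ avm G) × (avm G ≡ avm (θ¹₃₃ n) ⇔ G ≅ θ¹₃₃ n)

-- The inequality is strict here, so equal averages are contradictory and only the passage from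
-- isomorphism to equality has content.
all-large : ∀ {n} (G : Graph n) → count G * 2 ℕ.≤ sumSizes G → Conclusion G
all-large {n} G large = avm-≤ θ G (ℕ.<⇒≤ θ<G) ,
  mk⇔ (λ eq → contradiction (sym (avm-≡⁻ G θ eq)) (ℕ.<⇒≢ θ<G)) (≅θ⇒avm≡ G)
  where
  open ℕ.≤-Reasoning
  θ = θ¹₃₃ n

  θ<G : sumSizes θ * count G ℕ.< sumSizes G * count θ
  θ<G = begin-strict
    sumSizes θ * count G            <⟨ ℕ.*-monoˡ-< (count G) {{count-nonZero G}} (ℕ.n<1+n (sumSizes θ)) ⟩
    suc (sumSizes θ) * count G      ≡⟨ cong (_* count G) (leafy-sumSizes (θ-leafy (n ∸ 4))) ⟩
    count θ * 2 * count G           ≡⟨ solve 2 (λ m n → m :* con 2 :* n := n :* con 2 :* m) refl (count θ) (count G) ⟩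
    count G * 2 * count θ           ≤⟨ ℕ.*-monoˡ-≤ (count θ) large ⟩
    sumSizes G * count θ            ∎
    where open +-*-Solver

module _ {n} (G : Graph n) (size≡ : size G ≡ n + 1) {a b} (cov : EdgeCover G a b) where

  private
    θ = θ¹₃₃ n

    degrees : deg G a b + deg G b a ≡ n
    degrees = ℕ.suc-injective (begin
      suc (deg G a b + deg G b a)   ≡⟨ size≡1+deg+deg G cov ⟨
      size G                        ≡⟨ size≡ ⟩
      n + 1                         ≡⟨ ℕ.+-comm n 1 ⟩
      suc n                         ∎)
      where open ≡-Reasoning

    -- The n + 1 edges make the two values of `deg` add up to n, while the vertex count makes them
    -- add up to n - 2 + `codeg G a b`.
    codeg≡2 : codeg G a b ≡ 2
    codeg≡2 = ℕ.+-cancelˡ-≡ n _ _ (begin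
      n + codeg G a b               ≡⟨ deg+deg G cov ⟨
      2 + (deg G a b + deg G b a)   ≡⟨ cong (2 +_) degrees ⟩
      2 + n                         ≡⟨ ℕ.+-comm 2 n ⟩
      n + 2                         ∎)
      where open ≡-Reasoning

  covered : Conclusion G
  covered =
    let c , d , c∈ , d∈ , c≢d = length≡2⇒pair codeg≡2 (commonNeighbours-unique G a b)
    in conclusion c∈ d∈ c≢d
    where
    conclusion : ∀ {c d} → c List.∈ commonNeighbours G a b → d List.∈ commonNeighbours G a b → c ≢ d → Conclusion G
    conclusion {c} {d} c∈ d∈ c≢d = avm-≤ θ G θ≤G , mk⇔ extremal (≅θ⇒avm≡ G)
      where
      ac = proj₁ (∈-commonNeighbours⁻ G c∈)
      bc = proj₂ (∈-commonNeighbours⁻ G c∈)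
      ad = proj₁ (∈-commonNeighbours⁻ G d∈)
      bd = proj₂ (∈-commonNeighbours⁻ G d∈)

      s t : ℕ
      -- No truncation occurs: `c` and `d` are two distinct other neighbours of both `a` and `b`.
      s = deg G a b ∸ 2
      t = deg G b a ∸ 2

      deg-a : 2 + s ≡ deg G a b
      deg-a = ℕ.m+[n∸m]≡n (pair⇒length≥2 (∈-otherNeighbours⁺ G ac) (∈-otherNeighbours⁺ G ad) c≢d)

      deg-b : 2 + t ≡ deg G b a
      deg-b = ℕ.m+[n∸m]≡n (pair⇒length≥2 (∈-otherNeighbours⁺ G bc) (∈-otherNeighbours⁺ G bd) c≢d)

      n≡ : n ≡ 4 + (s + t)
      n≡ = begin
        n                       ≡⟨ degrees ⟨
        deg G a b + deg G b a   ≡⟨ cong₂ _+_ deg-a deg-b ⟨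
        2 + s + (2 + t)         ≡⟨ solve 2 (λ s t → con 2 :+ s :+ (con 2 :+ t) := con 4 :+ (s :+ t)) refl s t ⟩
        4 + (s + t)             ∎
        where
        open ≡-Reasoning
        open +-*-Solver

      count≡ : count G ≡ count θ + s * t
      count≡ = ℕ.+-cancelʳ-≡ 5 _ _ (begin
        -- The 5 is that of `leafy-count`; its part 2 is the number of common neighbours, as needed
        -- for `count+codeg`.
        count G + 5                       ≡⟨ ℕ.+-assoc (count G) 2 3 ⟨
        count G + 2 + 3                   ≡⟨ cong (λ k → count G + k + 3) codeg≡2 ⟨
        count G + codeg G a b + 3         ≡⟨ cong (_+ 3) (count+codeg G cov c≢d ac bc ad bd) ⟩
        suc (deg G a b * deg G b a) + 3   ≡⟨ cong₂ (λ i j → suc (i * j) + 3) deg-a deg-b ⟨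
        suc ((2 + s) * (2 + t)) + 3       ≡⟨ solve 2 (λ s t → con 1 :+ (con 2 :+ s) :* (con 2 :+ t) :+ con 3
                                                          := (con 4 :+ (s :+ t)) :* con 2 :+ s :* t) refl s t ⟩
        (4 + (s + t)) * 2 + s * t         ≡⟨ cong (λ k → (4 + (k ∸ 4)) * 2 + s * t) n≡ ⟨
        (4 + (n ∸ 4)) * 2 + s * t         ≡⟨ cong (_+ s * t) (leafy-count (θ-leafy (n ∸ 4))) ⟨
        count θ + 5 + s * t               ≡⟨ solve 2 (λ k l → k :+ con 5 :+ l := k :+ l :+ con 5) refl (count θ) (s * t) ⟩
        count θ + s * t + 5               ∎)
        where
        open ≡-Reasoning
        open +-*-Solver

      crossed : sumSizes θ * count G + count G ≡ sumSizes G * count θ + count θ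
      crossed = cross-multiply (leafy-sumSizes (θ-leafy (n ∸ 4))) (suc-sumSizes G cov c≢d ac bc ad bd)

      θ≤G : sumSizes θ * count G ℕ.≤ sumSizes G * count θ
      θ≤G = ℕ.+-cancelʳ-≤ (count θ) _ _ (begin
        -- The excess `s * t` of the count of `G` over that of θ is what gives the inequality.
        sumSizes θ * count G + count θ    ≤⟨ ℕ.+-monoʳ-≤ _ (ℕ.≤-trans (ℕ.m≤m+n _ _) (ℕ.≤-reflexive (sym count≡))) ⟩
        sumSizes θ * count G + count G    ≡⟨ crossed ⟩
        sumSizes G * count θ + count θ    ∎)
        where open ℕ.≤-Reasoning

      neighbours : ∀ {i j} → OtherNeighbour G i j c → OtherNeighbour G i j d → deg G i j ≡ 2 →
                   ∀ {v} → Adj G i v → v ≡ j ⊎ v ≡ c ⊎ v ≡ d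
      neighbours {j = j} ic id deg≡2 {v} i~v with v Fin.≟ j
      ... | yes v≡j = inj₁ v≡j
      ... | no v≢j  = inj₂ (pair-exhausts deg≡2 (∈-otherNeighbours⁺ G ic) (∈-otherNeighbours⁺ G id) c≢d
                              (∈-otherNeighbours⁺ G (i~v , v≢j)))

      st≡0 : avm G ≡ avm θ → s * t ≡ 0
      st≡0 eq = ℕ.+-cancelˡ-≡ (count θ) _ _ (trans (sym count≡) (trans count-same (sym (ℕ.+-identityʳ _))))
        where
        count-same : count G ≡ count θ
        count-same = ℕ.+-cancelˡ-≡ (sumSizes θ * count G) _ _
          (trans crossed (cong (_+ count θ) (avm-≡⁻ G θ eq)))

      extremal : avm G ≡ avm θ → G ≅ θ
      extremal eq = [ few-at-a , few-at-b ]′ (ℕ.m*n≡0⇒m≡0∨n≡0 s (st≡0 eq))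
        where
        -- Now `a` has only `b`, `c` and `d` as neighbours, so the roles are exchanged and `b`
        -- carries the leaves.
        few-at-a : s ≡ 0 → G ≅ θ
        few-at-a s≡0 = leafy⇒≅θ (record
          { cover = EdgeCover-sym cov ; c≢d = c≢d
          ; a~c = proj₁ bc ; b~c = proj₁ ac ; a~d = proj₁ bd ; b~d = proj₁ ad
          ; b-neighbours = neighbours ac ad (trans (sym deg-a) (cong (2 +_) s≡0))
          })

        few-at-b : t ≡ 0 → G ≅ θ
        few-at-b t≡0 = leafy⇒≅θ (record
          { cover = cov ; c≢d = c≢d
          ; a~c = proj₁ ac ; b~c = proj₁ bc ; a~d = proj₁ ad ; b~d = proj₁ bd
          ; b-neighbours = neighbours bc bd (trans (sym deg-b) (cong (2 +_) t≡0))
          })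

theorem2p1 : ∀ (n : ℕ) (G : Graph n) →
    Connected G →
    size G ≡ n + 1 →
    (∃[ p ] ∃[ q ] ∃[ l ] 𝒜 p q l G) →
    (avm (θ¹₃₃ n) ≤ avm G) × (avm G ≡ avm (θ¹₃₃ n) ⇔ G ≅ θ¹₃₃ n)
theorem2p1 n G connected size≡ _ = by-cases (Fin.any? (λ e → Fin.all? (meets? G e)))
  where
  by-cases : Dec (∃[ e ] ∀ f → Meets G e f) → Conclusion G
  by-cases (yes (e , meets)) = covered G size≡ (cover-from-edge G connected e meets)
  -- With n + 1 edges there is at least one, which supplies the edge that `sumSizes-≥` asks for.
  by-cases (no ¬meets) = all-large G (sumSizes-≥ G (subst Fin (trans (ℕ.+-comm 1 n) (sym size≡)) zero)
    λ e → Fin.¬∀⟶∃¬ _ (Meets G e) (meets? G e) (λ all → ¬meets (e , all)))
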